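{- For $0<\varepsilon<\frac{1}{21}$, Algorithm ED-Approx (run on $S,S',N,\mathrm{Dec}_{\mathcal C}$) computes a set of up to $(1+11\varepsilon)\cdot\mathrm{ED}(S,S')$ insertions and deletions that turn $S$ into $S'$.
   Context: $\mathrm{ED}(A,B)$ is the minimum number of single-character insertions and deletions (no substitutions) needed to transform $A$ into $B$. Setting. Let $\mathcal C$ be an insertion-deletion code over alphabet $\Sigma_{\mathcal C}$ with block length $N$ and rate $r$ that is $L$-list decodable from any $N(1-\varepsilon)$ deletions and $N(1-\varepsilon)$ insertions: for a string $y$, the decoder output $\mathrm{Dec}_{\mathcal C}(y)$ is the set (of size at most $L$) of all indices $j$ such that the $j$-th codeword $\mathcal C(j)$ can be turned into $y$ by $N(1-\varepsilon)$ deletions and $N(1-\varepsilon)$ insertions. Let $I$ be the concatenation $\mathcal C(1)\mathcal C(2)\cdots$ of all $|\Sigma_{\mathcal C}|^{Nr}$ codewords, $m$ an arbitrary content string with $|m|=|I|=N|\Sigma_{\mathcal C}|^{Nr}$, and $S$ the string with $S_i=(m_i,I_i)$. $S'$ is a given string over the same product alphabet. Both $S$ and $S'$ are split into consecutive blocks of length $N$; $S(i)$ and $S'(i)$ denote the $i$-th blocks, and $C'_i$ denotes the index component (over $\Sigma_{\mathcal C}$) of $S'(i)$. Algorithm ED-Approx. Let $w=1/\varepsilon$. Start with an empty bipartite graph $G$ whose two parts are the positions of $S$ and the positions of $S'$. For each block $S'(i)$, compute the list $\mathrm{Dec}_{\mathcal C}(C'_i)$; for each $j$ in this list and each $k\in[j-w,j+w]$,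 connect the pairs of vertices of $G$ that correspond to identical symbols in $S(k)$ and $S'(i)$. Finally, return a largest non-crossing matching of $G$ (a set of edges $(u_{i_1},v_{j_1}),\dots,(u_{i_t},v_{j_t})$ with $i_1<\dots<i_t$ and $j_1<\dots<j_t$). The returned matching is identified with the set of operations that deletes every unmatched symbol of $S$ and inserts every unmatched symbol of $S'$.
   Formalization: The parameter ε is taken to be a rational number rather than a real one; S′ is split into full blocks of length N, so its length is a multiple of N. -}

module Defs where

open import Data.Fin.Base using (Fin; toℕ; combine; quotient) renaming (_<_ to _<ᶠ_)
open import Data.Fin.Subset using (Subset; inside; outside; ⁅_⁆; ⋃; ∁; ∣_∣; _∈_)
open import Data.Integer.Base using (+_)
open import Data.List.Base as List using (List; []; _∷_; _++_; length)
open import Data.List.Relation.Unary.All using (All)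
open import Data.List.Relation.Unary.AllPairs using (AllPairs)
open import Data.Nat.Base as ℕ using (ℕ; suc)
open import Data.Product using (_×_; _,_; proj₁; proj₂; ∃-syntax)
open import Data.Rational.Base using (ℚ; 0ℚ; 1ℚ; Positive; _/_; 1/_; _*_; _-_; _≤_)
open import Data.Rational.Properties using (pos⇒nonZero)
open import Data.Vec.Base as Vec using (Vec; []; _∷_; lookup; tabulate; concat; zip; toList)
open import Function.Bundles using (_⇔_)
open import Level using (0ℓ)
open import Relation.Binary.Core using (REL)
open import Relation.Binary.PropositionalEquality using (_≡_)

private
  variable
    A : Set
    p q N M L k a b : ℕ

fromℕ : ℕ → ℚ
fromℕ n = + n / 1

-- Transforms d i xs ys: some sequence of exactly d single-character deletions
-- and i single-character insertions, in any order, turns xs into ys.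
data Transforms {A : Set} : ℕ → ℕ → List A → List A → Set where
  done   : ∀ {xs} → Transforms 0 0 xs xs
  delete : ∀ {d i ys} us x vs →
           Transforms d i (us ++ vs) ys → Transforms (suc d) i (us ++ x ∷ vs) ys
  insert : ∀ {d i ys} us x vs →
           Transforms d i (us ++ x ∷ vs) ys → Transforms d (suc i) (us ++ vs) ys

-- n is the minimum number of insertions and deletions, i.e. n = ED(xs, ys).
IsED : List A → List A → ℕ → Set
IsED xs ys n =
  (∃[ d ] ∃[ i ] (d ℕ.+ i ≡ n × Transforms d i xs ys)) ×
  (∀ d i → Transforms d i xs ys → n ℕ.≤ d ℕ.+ i)

-- M codewords of length N over an alphabet of size q.  The rate r is the real
-- number with M = q ^ (N r); leaving M free allows every rate.
Code : (q N M : ℕ) → Set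
Code q N M = Fin M → Vec (Fin q) N

Correctable : ℚ → Code q N M → List (Fin q) → Fin M → Set
Correctable {N = N} ε C y j =
  ∃[ d ] ∃[ i ] (fromℕ d ≤ fromℕ N * (1ℚ - ε) × fromℕ i ≤ fromℕ N * (1ℚ - ε) ×
                 Transforms d i (toList (C j)) y)

record ListDecoder (C : Code q N M) (L : ℕ) (ε : ℚ) : Set where
  field
    dec      : List (Fin q) → Subset M
    dec-spec : ∀ y j → j ∈ dec y ⇔ Correctable ε C y j
    dec-size : ∀ y → ∣ dec y ∣ ℕ.≤ L

indexString : Code q N M → Vec (Fin q) (M ℕ.* N)
indexString C = concat (tabulate C)

indexed : Code q N M → Vec (Fin p) (M ℕ.* N) → Vec (Fin p × Fin q) (M ℕ.* N)
indexed C m = zip m (indexString C)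

block : (k N : ℕ) → Vec A (k ℕ.* N) → Fin k → Vec A N
block k N xs i = tabulate λ t → lookup xs (combine i t)

-- w = 1/ε.
window : (ε : ℚ) .{{_ : Positive ε}} → ℚ
window ε = (1/ ε) {{pos⇒nonZero ε}}

-- Position u of S lies in block S(quotient N u), position v of S′ in
-- S′(quotient N v).  Membership in [j - w, j + w] is tested as a distance, so w
-- need not be an integer.
approxGraph : (N M k : ℕ) (ε : ℚ) .{{_ : Positive ε}} → (List (Fin q) → Subset M) →
              Vec (Fin p × Fin q) (M ℕ.* N) → Vec (Fin p × Fin q) (k ℕ.* N) →
              REL (Fin (M ℕ.* N)) (Fin (k ℕ.* N)) 0ℓ
approxGraph N M k ε dec S S′ u v = ∃[ j ]
  ( j ∈ dec (toList (Vec.map proj₂ (block k N S′ (quotient {k} N v))))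
  × fromℕ ℕ.∣ toℕ (quotient {M} N u) - toℕ j ∣ ≤ window ε
  × lookup S u ≡ lookup S′ v )

NonCrossingMatching : REL (Fin a) (Fin b) 0ℓ → List (Fin a × Fin b) → Set
NonCrossingMatching G E =
  All (λ (u , v) → G u v) E ×
  AllPairs (λ (u , v) (u′ , v′) → u <ᶠ u′ × v <ᶠ v′) E

IsLargestNonCrossingMatching : REL (Fin a) (Fin b) 0ℓ → List (Fin a × Fin b) → Set
IsLargestNonCrossingMatching G E =
  NonCrossingMatching G E ×
  (∀ E′ → NonCrossingMatching G E′ → length E′ ℕ.≤ length E)

-- The algorithm does not specify which largest matching it returns, so its
-- output is a relation: E is a possible result.
ED-Approx : (N M k : ℕ) (ε : ℚ) .{{_ : Positive ε}} → (List (Fin q) → Subset M) →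
            Vec (Fin p × Fin q) (M ℕ.* N) → Vec (Fin p × Fin q) (k ℕ.* N) →
            List (Fin (M ℕ.* N) × Fin (k ℕ.* N)) → Set
ED-Approx N M k ε dec S S′ =
  IsLargestNonCrossingMatching (approxGraph N M k ε dec S S′)

deletions : List (Fin a × Fin b) → Subset a
deletions E = ∁ (⋃ (List.map (λ e → ⁅ proj₁ e ⁆) E))

insertions : List (Fin a × Fin b) → Subset b
insertions E = ∁ (⋃ (List.map (λ e → ⁅ proj₂ e ⁆) E))

deleteAt : Subset a → Vec A a → List A
deleteAt []            []       = []
deleteAt (inside  ∷ D) (x ∷ xs) = deleteAt D xs
deleteAt (outside ∷ D) (x ∷ xs) = x ∷ deleteAt D xs

-- Inserts into zs the symbols of ys at the positions in J (positions of the
-- resulting string); the other positions are filled by zs in order, never by ys.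
insertAt : Subset b → Vec A b → List A → List A
insertAt []            []       zs       = zs
insertAt (inside  ∷ J) (y ∷ ys) zs       = y ∷ insertAt J ys zs
insertAt (outside ∷ J) (y ∷ ys) (z ∷ zs) = z ∷ insertAt J ys zs
insertAt (outside ∷ J) (y ∷ ys) []       = insertAt J ys []

{-# OPTIONS --safe #-}

-- Let E be the set of edges of an optimal alignment of S and S′. As E is non-crossing, S can
-- be cut at positions 0 = c₀ ≤ c₁ ≤ … ≤ c_k = |S| such that every edge into the block S′(i)
-- starts in [cᵢ, cᵢ₊₁), so ED(S, S′) is the sum over i of (cᵢ₊₁ - cᵢ) + N - 2 eᵢ, with eᵢ the
-- number of edges into S′(i). Keep these eᵢ edges if they all lie in G, and drop them
-- otherwise. If [cᵢ, cᵢ₊₁) meets s blocks of S and the edges are dropped, then eᵢ ≤ s ε N: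
-- either s > 1/ε, and this holds as eᵢ ≤ N; or each of the s blocks has fewer than ε N of the
-- edges, because a block with at least ε N of them is in the list decoded from S′(i), and the
-- other s - 1 blocks are within its window. Since (s - 2) N ≤ cᵢ₊₁ - cᵢ, the 2 eᵢ additional
-- operations are paid for by 11 ε times the summand of i.
module Submission where

open import Data.Fin.Base
  using (Fin; zero; suc; toℕ; fromℕ<; combine; quotient; remainder)
  renaming (_<_ to _<ᶠ_)
open import Data.Fin.Properties
  using (any?; toℕ<n; toℕ-fromℕ<; toℕ-injective; toℕ-combine; combine-remQuot; nonZeroIndex)
  renaming (_≟_ to _≟ᶠ_)
open import Data.Fin.Subset using (Subset; inside; outside; ⁅_⁆; _∪_; ⋃; ∁; ∣_∣; _∈_)
open import Data.Fin.Subset.Properties using (∪-identityˡ; ∣∁p∣≡n∸∣p∣; ∣p∣≤n; _∈?_)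
open import Data.Integer.Base as ℤ using (+_; +[1+_])
import Data.Integer.Properties as ℤ
open import Data.List.Base as List using (List; []; _∷_; _++_; [_]; length; map; filter)
open import Data.List.Properties
  using (map-∘; map-cong; map-cong-local; map-id-local; length-map; length-++; length-++-sucʳ; ++-assoc;
         ∷-injectiveˡ; ∷-injectiveʳ; filter-all)
open import Data.List.Membership.Propositional using (find)
open import Data.List.Relation.Binary.Sublist.Propositional
  using (_⊆_; []; _∷_; _∷ʳ_; ⊆-refl; ⊆-trans; minimum)
open import Data.List.Relation.Binary.Sublist.Propositional.Properties
  using (All-resp-⊆; filter-⊆; filter⁺; length-mono-≤)
  renaming (++⁺ to ⊆-++⁺; map⁺ to ⊆-map⁺)
open import Data.List.Relation.Unary.All as All using (All; []; _∷_)
open import Data.List.Relation.Unary.All.Properties using (all-filter; ¬Any⇒All¬)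
  renaming (map⁺ to All-map⁺; map⁻ to All-map⁻; ++⁺ to All-++⁺; ++⁻ˡ to All-++⁻ˡ; ++⁻ʳ to All-++⁻ʳ;
            filter⁺ to All-filter⁺)
open import Data.List.Relation.Unary.AllPairs as AllPairs using (AllPairs; []; _∷_)
open import Data.List.Relation.Unary.AllPairs.Properties
  using ()
  renaming (map⁺ to AllPairs-map⁺; map⁻ to AllPairs-map⁻)
open import Data.List.Relation.Unary.Any as Any using ()
open import Data.Nat.Base as ℕ using (ℕ; zero; suc; z≤n; s≤s; NonZero)
open import Data.Nat.DivMod using (m/n*n≤m; m≡m%n+[m/n]*n; m%n<n)
import Data.Nat.Properties as ℕ
open import Data.Nat.Tactic.RingSolver using (solve-∀)
open import Data.Product using (_×_; _,_; proj₁; proj₂; ∃-syntax)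
open import Data.Product.Properties using (≡-dec)
open import Data.Rational.Base as ℚ using (ℚ; mkℚ; 1ℚ; Positive; toℚᵘ)
import Data.Rational.Properties as ℚ
open import Data.Rational.Solver using (module +-*-Solver)
import Data.Rational.Unnormalised.Base as ℚᵘ
import Data.Rational.Unnormalised.Properties as ℚᵘ
open import Data.Sum.Base using (inj₁; inj₂)
open import Data.Vec.Base as Vec using (Vec; []; _∷_; lookup; tabulate; toList)
open import Data.Vec.Properties
  using (lookup∘tabulate; tabulate∘lookup; tabulate-∘; tabulate-cong; lookup-concat; lookup-zip;
         toList-map; length-toList)
open import Function.Base using (_∘_)
open import Function.Bundles using (module Equivalence)
open import Level using (0ℓ)
open import Relation.Binary.Core using (Rel; REL)
import Relation.Binary.Definitions as B
open import Relation.Binary.PropositionalEquality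
  using (_≡_; refl; sym; trans; cong; cong₂; subst; subst₂; module ≡-Reasoning)
open import Relation.Nullary using (Dec; yes; no; contradiction)
open import Relation.Nullary.Decidable using (¬?; _×-dec_)
open import Relation.Unary using (Pred; Decidable)
open import Defs

private
  variable
    A : Set
    a b : ℕ

-- Clearing the denominator of ε

module _ where

  open import Data.Rational.Base using (_/_; _+_; _*_; _-_; -_; _≤_; _<_)
  open import Data.Rational.Properties
    using (toℚᵘ-fromℚᵘ; toℚᵘ-injective; toℚᵘ-homo-+; toℚᵘ-homo-*; toℚᵘ-cancel-≤; toℚᵘ-mono-≤; normalize-pos;
           *-cancelʳ-≤-pos; *-cancelˡ-≤-pos; *-monoˡ-≤-nonNeg; *-monoʳ-≤-nonNeg; *-assoc; *-identityˡ;
           *-inverseˡ; +-assoc; +-inverseʳ; +-identityʳ; +-monoˡ-≤; pos⇒nonNeg; pos⇒nonZero; <⇒≤;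
           module ≤-Reasoning)

  -- Unnormalised fractions carry no gcd, so identities between values of `fromℕ` are checked there
  -- and transferred back.
  fromℕ-≃ : ∀ n → toℚᵘ (fromℕ n) ℚᵘ.≃ ℚᵘ.mkℚᵘ (+ n) 0
  fromℕ-≃ n = toℚᵘ-fromℚᵘ (ℚᵘ.mkℚᵘ (+ n) 0)

  fromℕ-+ : ∀ m n → fromℕ (m ℕ.+ n) ≡ fromℕ m + fromℕ n
  fromℕ-+ m n = toℚᵘ-injective (begin
    toℚᵘ (fromℕ (m ℕ.+ n))                     ≈⟨ fromℕ-≃ (m ℕ.+ n) ⟩
    ℚᵘ.mkℚᵘ (+ (m ℕ.+ n)) 0
      ≈⟨ ℚᵘ.*≡* (cong (ℤ._* + 1) (trans (ℤ.pos-+ m n) (sym (cong₂ ℤ._+_ (ℤ.*-identityʳ (+ m)) (ℤ.*-identityʳ (+ n)))))) ⟩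
    ℚᵘ.mkℚᵘ (+ m) 0 ℚᵘ.+ ℚᵘ.mkℚᵘ (+ n) 0       ≈⟨ ℚᵘ.+-cong (fromℕ-≃ m) (fromℕ-≃ n) ⟨
    toℚᵘ (fromℕ m) ℚᵘ.+ toℚᵘ (fromℕ n)         ≈⟨ toℚᵘ-homo-+ (fromℕ m) (fromℕ n) ⟨
    toℚᵘ (fromℕ m + fromℕ n)                   ∎)
    where open ℚᵘ.≃-Reasoning

  fromℕ-* : ∀ m n → fromℕ (m ℕ.* n) ≡ fromℕ m * fromℕ n
  fromℕ-* m n = toℚᵘ-injective (begin
    toℚᵘ (fromℕ (m ℕ.* n))                     ≈⟨ fromℕ-≃ (m ℕ.* n) ⟩
    ℚᵘ.mkℚᵘ (+ (m ℕ.* n)) 0                    ≈⟨ ℚᵘ.*≡* (cong (ℤ._* + 1) (ℤ.pos-* m n)) ⟩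
    ℚᵘ.mkℚᵘ (+ m) 0 ℚᵘ.* ℚᵘ.mkℚᵘ (+ n) 0       ≈⟨ ℚᵘ.*-cong (fromℕ-≃ m) (fromℕ-≃ n) ⟨
    toℚᵘ (fromℕ m) ℚᵘ.* toℚᵘ (fromℕ n)         ≈⟨ toℚᵘ-homo-* (fromℕ m) (fromℕ n) ⟨
    toℚᵘ (fromℕ m * fromℕ n)                   ∎)
    where open ℚᵘ.≃-Reasoning

  fromℕ-mono-≤ : ∀ {m n} → m ℕ.≤ n → fromℕ m ≤ fromℕ n
  fromℕ-mono-≤ {m} {n} m≤n = toℚᵘ-cancel-≤ (begin
    toℚᵘ (fromℕ m)     ≃⟨ fromℕ-≃ m ⟩
    ℚᵘ.mkℚᵘ (+ m) 0    ≤⟨ ℚᵘ.*≤* (ℤ.*-monoʳ-≤-nonNeg (+ 1) (ℤ.+≤+ m≤n)) ⟩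
    ℚᵘ.mkℚᵘ (+ n) 0    ≃⟨ fromℕ-≃ n ⟨
    toℚᵘ (fromℕ n)     ∎)
    where open ℚᵘ.≤-Reasoning

  fromℕ-cancel-≤ : ∀ {m n} → fromℕ m ≤ fromℕ n → m ℕ.≤ n
  fromℕ-cancel-≤ {m} {n} m≤n = ℤ.drop‿+≤+ (subst₂ ℤ._≤_ (ℤ.*-identityʳ (+ m)) (ℤ.*-identityʳ (+ n)) (ℚᵘ.drop-*≤* (begin
    ℚᵘ.mkℚᵘ (+ m) 0    ≃⟨ fromℕ-≃ m ⟨
    toℚᵘ (fromℕ m)     ≤⟨ toℚᵘ-mono-≤ m≤n ⟩
    toℚᵘ (fromℕ n)     ≃⟨ fromℕ-≃ n ⟩
    ℚᵘ.mkℚᵘ (+ n) 0    ∎)))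
    where open ℚᵘ.≤-Reasoning

  fromℕ-positive : ∀ n .{{_ : NonZero n}} → Positive (fromℕ n)
  fromℕ-positive n = normalize-pos n 1

  -- Writing `ε` as `P / Q` lets the counting below take place in ℕ, with inequalities multiplied by
  -- `Q`; `Fraction` translates between the two forms.
  fraction : ∀ ε .{{_ : Positive ε}} → ∃[ P ] ∃[ Q ] NonZero P × NonZero Q × fromℕ P ≡ ε * fromℕ Q
  fraction ε@(mkℚ +[1+ p ] d _) = suc p , suc d , _ , _ , toℚᵘ-injective (begin
    toℚᵘ (fromℕ (suc p))                       ≈⟨ fromℕ-≃ (suc p) ⟩
    ℚᵘ.mkℚᵘ (+ suc p) 0
      ≈⟨ ℚᵘ.*≡* (sym (trans (ℤ.*-identityʳ _) (cong (λ n → + suc p ℤ.* + n) (sym (ℕ.*-identityʳ (suc d)))))) ⟩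
    ℚᵘ.mkℚᵘ (+ suc p) d ℚᵘ.* ℚᵘ.mkℚᵘ (+ suc d) 0  ≈⟨ ℚᵘ.*-cong (ℚᵘ.≃-refl {toℚᵘ ε}) (fromℕ-≃ (suc d)) ⟨
    toℚᵘ ε ℚᵘ.* toℚᵘ (fromℕ (suc d))           ≈⟨ toℚᵘ-homo-* ε (fromℕ (suc d)) ⟨
    toℚᵘ (ε * fromℕ (suc d))                   ∎)
    where open ℚᵘ.≃-Reasoning

  module Fraction {ε : ℚ} .{{_ : Positive ε}} {P Q : ℕ} .{{P≢0 : NonZero P}} .{{Q≢0 : NonZero Q}}
                  (P≡ε*Q : fromℕ P ≡ ε * fromℕ Q) where

    private instance
      P⁺ : Positive (fromℕ P)
      P⁺ = fromℕ-positive P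
      Q⁺ : Positive (fromℕ Q)
      Q⁺ = fromℕ-positive Q

    <1/21⇒*11≤ : ε < + 1 / 21 → 11 ℕ.* P ℕ.≤ Q
    <1/21⇒*11≤ ε<1/21 = ℕ.≤-trans (ℕ.*-monoˡ-≤ P (ℕ.m≤m+n 11 10)) (fromℕ-cancel-≤ (begin
      fromℕ (21 ℕ.* P)                       ≡⟨ fromℕ-* 21 P ⟩
      fromℕ 21 * fromℕ P                     ≡⟨ cong (fromℕ 21 *_) P≡ε*Q ⟩
      fromℕ 21 * (ε * fromℕ Q)
        ≤⟨ *-monoˡ-≤-nonNeg (fromℕ 21) (*-monoʳ-≤-nonNeg (fromℕ Q) {{pos⇒nonNeg (fromℕ Q)}} (<⇒≤ ε<1/21)) ⟩
      fromℕ 21 * (+ 1 / 21 * fromℕ Q)        ≡⟨ *-assoc (fromℕ 21) (+ 1 / 21) (fromℕ Q) ⟨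
      1ℚ * fromℕ Q                           ≡⟨ *-identityˡ (fromℕ Q) ⟩
      fromℕ Q                                ∎))
      where open ≤-Reasoning

    -- Since `window ε * ε` is 1, the window is `Q / P`.
    ≤window : ∀ n → n ℕ.* P ℕ.≤ Q → fromℕ n ≤ window ε
    ≤window n nP≤Q = *-cancelʳ-≤-pos (fromℕ P) (begin
      fromℕ n * fromℕ P               ≡⟨ fromℕ-* n P ⟨
      fromℕ (n ℕ.* P)                 ≤⟨ fromℕ-mono-≤ nP≤Q ⟩
      fromℕ Q                         ≡⟨ *-identityˡ (fromℕ Q) ⟨
      1ℚ * fromℕ Q                    ≡⟨ cong (_* fromℕ Q) (*-inverseˡ ε {{pos⇒nonZero ε}}) ⟨
      window ε * ε * fromℕ Q          ≡⟨ *-assoc (window ε) ε (fromℕ Q) ⟩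
      window ε * (ε * fromℕ Q)        ≡⟨ cong (window ε *_) P≡ε*Q ⟨
      window ε * fromℕ P              ∎)
      where open ≤-Reasoning

    -- In the application `n` is the length of a common subsequence of two strings of length `N`,
    -- and `d` counts the symbols of one string outside it; `P * N ≤ Q * n` means that `n` is at
    -- least `ε N`. Adding `P * N` to both sides avoids a subtraction.
    ≤*[1-ε] : ∀ d n N → d ℕ.+ n ≡ N → P ℕ.* N ℕ.≤ Q ℕ.* n → fromℕ d ≤ fromℕ N * (1ℚ - ε)
    ≤*[1-ε] d n N d+n≡N PN≤Qn = *-cancelʳ-≤-pos (fromℕ Q) (+-cancelʳ-≤ (fromℕ (P ℕ.* N)) (begin
      fromℕ d * fromℕ Q + fromℕ (P ℕ.* N)        ≡⟨ cong (_+ fromℕ (P ℕ.* N)) (fromℕ-* d Q) ⟨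
      fromℕ (d ℕ.* Q) + fromℕ (P ℕ.* N)          ≡⟨ fromℕ-+ (d ℕ.* Q) (P ℕ.* N) ⟨
      fromℕ (d ℕ.* Q ℕ.+ P ℕ.* N)                ≤⟨ fromℕ-mono-≤ (ℕ.+-monoʳ-≤ (d ℕ.* Q) PN≤Qn) ⟩
      fromℕ (d ℕ.* Q ℕ.+ Q ℕ.* n)                ≡⟨ cong fromℕ dQ+Qn≡NQ ⟩
      fromℕ (N ℕ.* Q)                            ≡⟨ fromℕ-* N Q ⟩
      fromℕ N * fromℕ Q                          ≡⟨ split ⟩
      fromℕ N * (1ℚ - ε) * fromℕ Q + fromℕ (P ℕ.* N) ∎))
      where
      open ≤-Reasoning
      open +-*-Solver using (solve; con; _:+_; _:*_; _:-_; _:=_)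
      +-cancelʳ-≤ : ∀ r {p q} → p + r ≤ q + r → p ≤ q
      +-cancelʳ-≤ r {p} {q} p+r≤q+r = subst₂ _≤_ (cancel p r) (cancel q r) (+-monoˡ-≤ (- r) p+r≤q+r)
        where
        cancel : ∀ p r → p + r - r ≡ p
        cancel p r = trans (+-assoc p r (- r)) (trans (cong (_+_ p) (+-inverseʳ r)) (+-identityʳ p))
      dQ+Qn≡NQ : d ℕ.* Q ℕ.+ Q ℕ.* n ≡ N ℕ.* Q
      dQ+Qn≡NQ = trans (cong (d ℕ.* Q ℕ.+_) (ℕ.*-comm Q n)) (trans (sym (ℕ.*-distribʳ-+ Q d n)) (cong (ℕ._* Q) d+n≡N))
      split : fromℕ N * fromℕ Q ≡ fromℕ N * (1ℚ - ε) * fromℕ Q + fromℕ (P ℕ.* N)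
      split = trans
        (solve 3 (λ N ε Q → N :* Q := N :* (con 1ℚ :- ε) :* Q :+ (ε :* Q) :* N) refl (fromℕ N) ε (fromℕ Q))
        (cong (_+_ (fromℕ N * (1ℚ - ε) * fromℕ Q)) (trans (cong (_* fromℕ N) (sym P≡ε*Q)) (sym (fromℕ-* P N))))

    ≤[1+11ε]* : ∀ t e → Q ℕ.* t ℕ.≤ (Q ℕ.+ 11 ℕ.* P) ℕ.* e → fromℕ t ≤ (1ℚ + (+ 11 / 1) * ε) * fromℕ e
    ≤[1+11ε]* t e Qt≤ = *-cancelˡ-≤-pos (fromℕ Q) (begin
      fromℕ Q * fromℕ t                                ≡⟨ fromℕ-* Q t ⟨
      fromℕ (Q ℕ.* t)                                  ≤⟨ fromℕ-mono-≤ Qt≤ ⟩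
      fromℕ ((Q ℕ.+ 11 ℕ.* P) ℕ.* e)                   ≡⟨ fromℕ-* (Q ℕ.+ 11 ℕ.* P) e ⟩
      fromℕ (Q ℕ.+ 11 ℕ.* P) * fromℕ e                 ≡⟨ cong (_* fromℕ e) (fromℕ-+ Q (11 ℕ.* P)) ⟩
      (fromℕ Q + fromℕ (11 ℕ.* P)) * fromℕ e
        ≡⟨ cong (λ p → (fromℕ Q + p) * fromℕ e) (trans (fromℕ-* 11 P) (cong (fromℕ 11 *_) P≡ε*Q)) ⟩
      (fromℕ Q + fromℕ 11 * (ε * fromℕ Q)) * fromℕ e
        ≡⟨ solve 4 (λ Q ε e c → (Q :+ c :* (ε :* Q)) :* e := Q :* ((con 1ℚ :+ c :* ε) :* e)) refl (fromℕ Q) ε (fromℕ e) (fromℕ 11) ⟩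
      fromℕ Q * ((1ℚ + fromℕ 11 * ε) * fromℕ e)        ∎)
      where
      open ≤-Reasoning
      open +-*-Solver using (solve; con; _:+_; _:*_; _:=_)

open import Data.Nat.Base using (_+_; _*_; _≤_; _<_; _∸_; _/_; ∣_-_∣)

-- Common subsequences and non-crossing matchings

-- The encoding follows the recursion on `a` that vectors, `Subset a` and the sublist relation
-- share: `skip` leaves the first position out, `take` includes it.
data Increasing : ∀ {a} → List (Fin a) → Set where
  []   : Increasing {0} []
  skip : ∀ {a} {us : List (Fin a)} → Increasing us → Increasing (map suc us)
  take : ∀ {a} {us : List (Fin a)} → Increasing us → Increasing (zero ∷ map suc us)

AllPairs⇒Increasing : {us : List (Fin a)} → AllPairs _<ᶠ_ us → Increasing us
AllPairs⇒Increasing {zero}  []            = []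
AllPairs⇒Increasing {zero}  (_∷_ {x = ()} _ _)
AllPairs⇒Increasing {suc a} {us} us< = go us us<
  where
  unsuc : ∀ us → All (zero {n = a} <ᶠ_) us → AllPairs _<ᶠ_ us →
          ∃[ us′ ] us ≡ map suc us′ × AllPairs _<ᶠ_ us′
  unsuc [] _ _ = [] , refl , []
  unsuc (suc u ∷ us) (_ ∷ 0<us) (u<us ∷ us<) with unsuc us 0<us us<
  ... | us′ , refl , us′< = u ∷ us′ , refl ,
    All.map ℕ.s≤s⁻¹ (All-map⁻ u<us) ∷ us′<

  go : ∀ us → AllPairs _<ᶠ_ us → Increasing us
  go [] _ = skip (AllPairs⇒Increasing [])
  go (zero ∷ us) (0<us ∷ us<) with unsuc us 0<us us<
  ... | us′ , refl , us′< = take (AllPairs⇒Increasing us′<)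
  -- All later entries exceed `suc u`, hence zero, so the whole list is a shift and the first
  -- position is skipped.
  go (suc u ∷ us) us<@(u<us ∷ _) with unsuc (suc u ∷ us) (s≤s z≤n ∷ All.map (ℕ.≤-trans (s≤s z≤n)) u<us) us<
  ... | us′ , eq , us′< rewrite eq = skip (AllPairs⇒Increasing us′<)

Increasing⇒AllPairs : {us : List (Fin a)} → Increasing us → AllPairs _<ᶠ_ us
Increasing⇒AllPairs []         = []
Increasing⇒AllPairs (skip us↑) = AllPairs-map⁺ (AllPairs.map s≤s (Increasing⇒AllPairs us↑))
Increasing⇒AllPairs (take {us = us} us↑) =
  All-map⁺ (All.universal (λ _ → s≤s z≤n) us) ∷ AllPairs-map⁺ (AllPairs.map s≤s (Increasing⇒AllPairs us↑))

map-lookup-suc : ∀ (x : A) (xs : Vec A a) us → map (lookup (x ∷ xs)) (map suc us) ≡ map (lookup xs) us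
map-lookup-suc x xs us = sym (map-∘ us)

Increasing⇒⊆ : (xs : Vec A a) {us : List (Fin a)} → Increasing us → map (lookup xs) us ⊆ toList xs
Increasing⇒⊆ []       []                = []
Increasing⇒⊆ (x ∷ xs) (skip {us = us} us↑) rewrite map-lookup-suc x xs us = x ∷ʳ Increasing⇒⊆ xs us↑
Increasing⇒⊆ (x ∷ xs) (take {us = us} us↑) rewrite map-lookup-suc x xs us = refl ∷ Increasing⇒⊆ xs us↑

⊆⇒Increasing : (xs : Vec A a) {zs : List A} → zs ⊆ toList xs →
               ∃[ us ] Increasing us × map (lookup xs) us ≡ zs
⊆⇒Increasing []       []          = [] , [] , refl
⊆⇒Increasing (x ∷ xs) (.x ∷ʳ zs⊆) with ⊆⇒Increasing xs zs⊆
... | us , us↑ , refl = map suc us , skip us↑ , map-lookup-suc x xs us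
⊆⇒Increasing (x ∷ xs) (refl ∷ zs⊆) with ⊆⇒Increasing xs zs⊆
... | us , us↑ , refl = zero ∷ map suc us , take us↑ , cong (x ∷_) (map-lookup-suc x xs us)

positions : List (Fin a) → Subset a
positions us = ⋃ (map ⁅_⁆ us)

positions-suc : (us : List (Fin a)) → positions (map suc us) ≡ outside ∷ positions us
positions-suc []       = refl
positions-suc (u ∷ us) = cong (⁅ suc u ⁆ ∪_) (positions-suc us)

positions-zero∷suc : (us : List (Fin a)) → positions (zero ∷ map suc us) ≡ inside ∷ positions us
positions-zero∷suc us = trans (cong (⁅ zero ⁆ ∪_) (positions-suc us)) (cong (inside ∷_) (∪-identityˡ (positions us)))

∣positions∣ : {us : List (Fin a)} → Increasing us → ∣ positions us ∣ ≡ length us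
∣positions∣ []                   = refl
∣positions∣ (skip {us = us} us↑) rewrite positions-suc us = trans (∣positions∣ us↑) (sym (length-map suc us))
∣positions∣ (take {us = us} us↑) rewrite positions-zero∷suc us =
  cong suc (trans (∣positions∣ us↑) (sym (length-map suc us)))

∣∁positions∣+length : {us : List (Fin a)} → Increasing us → ∣ ∁ (positions us) ∣ + length us ≡ a
∣∁positions∣+length {a} {us} us↑ = begin
  ∣ ∁ (positions us) ∣ + length us
    ≡⟨ cong₂ _+_ (∣∁p∣≡n∸∣p∣ (positions us)) (sym (∣positions∣ us↑)) ⟩
  a ∸ ∣ positions us ∣ + ∣ positions us ∣        ≡⟨ ℕ.m∸n+n≡m (∣p∣≤n (positions us)) ⟩
  a                                              ∎
  where open ≡-Reasoning

deleteAt-∁-positions : (xs : Vec A a) {us : List (Fin a)} → Increasing us →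
                       deleteAt (∁ (positions us)) xs ≡ map (lookup xs) us
deleteAt-∁-positions []       []                = refl
deleteAt-∁-positions (x ∷ xs) (skip {us = us} us↑) rewrite positions-suc us | map-lookup-suc x xs us =
  deleteAt-∁-positions xs us↑
deleteAt-∁-positions (x ∷ xs) (take {us = us} us↑) rewrite positions-zero∷suc us | map-lookup-suc x xs us =
  cong (x ∷_) (deleteAt-∁-positions xs us↑)

-- `deleteAt J` keeps exactly the symbols that `insertAt J` takes from its last argument, so the
-- default case for an exhausted string does not arise.
insertAt-deleteAt : (J : Subset a) (xs : Vec A a) → insertAt J xs (deleteAt J xs) ≡ toList xs
insertAt-deleteAt []            []       = refl
insertAt-deleteAt (inside  ∷ J) (x ∷ xs) = cong (x ∷_) (insertAt-deleteAt J xs)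
insertAt-deleteAt (outside ∷ J) (x ∷ xs) = cong (x ∷_) (insertAt-deleteAt J xs)

_≺_ : Rel (Fin a × Fin b) 0ℓ
(u , v) ≺ (u′ , v′) = u <ᶠ u′ × v <ᶠ v′

rows↑ : {E : List (Fin a × Fin b)} → AllPairs _≺_ E → Increasing (map proj₁ E)
rows↑ E≺ = AllPairs⇒Increasing (AllPairs-map⁺ (AllPairs.map proj₁ E≺))

columns↑ : {E : List (Fin a × Fin b)} → AllPairs _≺_ E → Increasing (map proj₂ E)
columns↑ E≺ = AllPairs⇒Increasing (AllPairs-map⁺ (AllPairs.map proj₂ E≺))

module _ {E : List (Fin a × Fin b)} (E≺ : AllPairs _≺_ E) where

  private
    deletions≡ : deletions E ≡ ∁ (positions (map proj₁ E))
    deletions≡ = cong (∁ ∘ ⋃) (map-∘ E)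

    insertions≡ : insertions E ≡ ∁ (positions (map proj₂ E))
    insertions≡ = cong (∁ ∘ ⋃) (map-∘ E)

  ∣deletions∣+length : ∣ deletions E ∣ + length E ≡ a
  ∣deletions∣+length = begin
    ∣ deletions E ∣ + length E
      ≡⟨ cong₂ _+_ (cong ∣_∣ deletions≡) (sym (length-map proj₁ E)) ⟩
    ∣ ∁ (positions (map proj₁ E)) ∣ + length (map proj₁ E)
      ≡⟨ ∣∁positions∣+length (rows↑ E≺) ⟩
    a                                                                       ∎
    where open ≡-Reasoning

  ∣insertions∣+length : ∣ insertions E ∣ + length E ≡ b
  ∣insertions∣+length = begin
    ∣ insertions E ∣ + length E
      ≡⟨ cong₂ _+_ (cong ∣_∣ insertions≡) (sym (length-map proj₂ E)) ⟩
    ∣ ∁ (positions (map proj₂ E)) ∣ + length (map proj₂ E)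
      ≡⟨ ∣∁positions∣+length (columns↑ E≺) ⟩
    b                                                                       ∎
    where open ≡-Reasoning

  -- The matched symbols of `xs` and of `ys` spell the same string: it is what the deletions leave
  -- of `xs`, and what the insertions complete to `ys`.
  edit-correct : (xs : Vec A a) (ys : Vec A b) → All (λ (u , v) → lookup xs u ≡ lookup ys v) E →
                 insertAt (insertions E) ys (deleteAt (deletions E) xs) ≡ toList ys
  edit-correct xs ys E= = begin
    insertAt (insertions E) ys (deleteAt (deletions E) xs)   ≡⟨ cong (insertAt (insertions E) ys) kept ⟩
    insertAt (insertions E) ys (deleteAt (insertions E) ys)  ≡⟨ insertAt-deleteAt (insertions E) ys ⟩
    toList ys                                                ∎
    where
    open ≡-Reasoning
    kept : deleteAt (deletions E) xs ≡ deleteAt (insertions E) ys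
    kept = begin
      deleteAt (deletions E) xs                       ≡⟨ cong (λ D → deleteAt D xs) deletions≡ ⟩
      deleteAt (∁ (positions (map proj₁ E))) xs       ≡⟨ deleteAt-∁-positions xs (rows↑ E≺) ⟩
      map (lookup xs) (map proj₁ E)                   ≡⟨ map-∘ E ⟨
      map (lookup xs ∘ proj₁) E                       ≡⟨ map-cong-local E= ⟩
      map (lookup ys ∘ proj₂) E                       ≡⟨ map-∘ E ⟩
      map (lookup ys) (map proj₂ E)                   ≡⟨ deleteAt-∁-positions ys (columns↑ E≺) ⟨
      deleteAt (∁ (positions (map proj₂ E))) ys       ≡⟨ cong (λ D → deleteAt D ys) insertions≡ ⟨
      deleteAt (insertions E) ys                      ∎

-- If `zs` uses the occurrence `x`, giving up that one symbol suffices; otherwise `zs` survives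
-- unchanged.
⊆-delete : ∀ us {x : A} {vs zs} → zs ⊆ us ++ x ∷ vs →
           ∃[ zs′ ] zs′ ⊆ zs × zs′ ⊆ us ++ vs × length zs ≤ suc (length zs′)
⊆-delete []       (_ ∷ʳ zs⊆)           = _ , ⊆-refl , zs⊆ , ℕ.n≤1+n _
⊆-delete []       (refl ∷ zs⊆)         = _ , _ ∷ʳ ⊆-refl , zs⊆ , ℕ.≤-refl
⊆-delete (u ∷ us) (_ ∷ʳ zs⊆) with ⊆-delete us zs⊆
... | zs′ , ⊆zs , ⊆us , ≤ = zs′ , ⊆zs , u ∷ʳ ⊆us , ≤
⊆-delete (u ∷ us) (refl ∷ zs⊆) with ⊆-delete us zs⊆
... | zs′ , ⊆zs , ⊆us , ≤ = u ∷ zs′ , refl ∷ ⊆zs , refl ∷ ⊆us , s≤s ≤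

-- Induction on the operations. A deletion leaves the common subsequence as it is; the symbol that
-- an insertion adds is absent from the string before it, so at most one symbol of the subsequence
-- is lost. Only inequalities hold, as a sequence may delete what it has inserted.
Transforms⇒⊆ : ∀ {d i} {xs ys : List A} → Transforms d i xs ys →
  ∃[ zs ] zs ⊆ xs × zs ⊆ ys × length xs ≤ length zs + d × length ys ≤ length zs + i
Transforms⇒⊆ {xs = xs} done = xs , ⊆-refl , ⊆-refl , ℕ.m≤m+n _ 0 , ℕ.m≤m+n _ 0
Transforms⇒⊆ (delete {d} us x vs t) with Transforms⇒⊆ t
... | zs , zs⊆xs , zs⊆ys , xs≤ , ys≤ =
  zs , ⊆-trans zs⊆xs (⊆-++⁺ (⊆-refl {x = us}) (x ∷ʳ ⊆-refl)) , zs⊆ys ,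
  subst₂ _≤_ (sym (length-++-sucʳ us x vs)) (sym (ℕ.+-suc (length zs) d)) (s≤s xs≤) , ys≤
Transforms⇒⊆ {ys = ys} (insert {d} {i} us x vs t) with Transforms⇒⊆ t
... | zs , zs⊆xs , zs⊆ys , xs≤ , ys≤ with ⊆-delete us zs⊆xs
... | zs′ , zs′⊆zs , zs′⊆xs , zs≤ =
  zs′ , zs′⊆xs , ⊆-trans zs′⊆zs zs⊆ys ,
  ℕ.s≤s⁻¹ (subst (_≤ suc (length zs′ + d)) (length-++-sucʳ us x vs) (ℕ.≤-trans xs≤ (ℕ.+-monoˡ-≤ d zs≤))) ,
  subst (length ys ≤_) (sym (ℕ.+-suc (length zs′) i)) (ℕ.≤-trans ys≤ (ℕ.+-monoˡ-≤ i zs≤))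

-- `us` is the prefix already passed. The constructors of `Transforms` prepend an operation, so `t`
-- holds the later operations: each symbol of `ys` outside `zs` is prepended as an insertion, and a
-- common symbol moves into `us`.
insert-⊆ : ∀ us {zs ys ts : List A} {d i} → zs ⊆ ys → Transforms d i (us ++ ys) ts →
           ∃[ i′ ] i′ + length zs ≡ i + length ys × Transforms d i′ (us ++ zs) ts
insert-⊆ us []          t = _ , refl , t
insert-⊆ us {zs} {y ∷ ys} {i = i} (_ ∷ʳ zs⊆) t with insert-⊆ us zs⊆ (insert us y _ t)
... | i′ , eq , t′ = i′ , trans eq (sym (ℕ.+-suc i (length ys))) , t′
insert-⊆ us {z ∷ zs} {_ ∷ ys} {ts} {d} {i} (refl ∷ zs⊆) t
  with insert-⊆ (us ++ [ z ]) zs⊆ (subst (λ xs → Transforms d i xs ts) (sym (++-assoc us [ z ] ys)) t)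
... | i′ , eq , t′ = i′ ,
  trans (ℕ.+-suc i′ (length zs)) (trans (cong suc eq) (sym (ℕ.+-suc i (length ys)))) ,
  subst (λ xs → Transforms d i′ xs ts) (++-assoc us [ z ] zs) t′

delete-⊆ : ∀ us {zs xs ts : List A} {d i} → zs ⊆ xs → Transforms d i (us ++ zs) ts →
           ∃[ d′ ] d′ + length zs ≡ d + length xs × Transforms d′ i (us ++ xs) ts
delete-⊆ us []          t = _ , refl , t
delete-⊆ us {zs} {x ∷ xs} {d = d} (_ ∷ʳ zs⊆) t with delete-⊆ us zs⊆ t
... | d′ , eq , t′ = suc d′ , trans (cong suc eq) (sym (ℕ.+-suc d (length xs))) , delete us x xs t′
delete-⊆ us {z ∷ zs} {_ ∷ xs} {ts} {d} {i} (refl ∷ zs⊆) t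
  with delete-⊆ (us ++ [ z ]) zs⊆ (subst (λ xs → Transforms d i xs ts) (sym (++-assoc us [ z ] zs)) t)
... | d′ , eq , t′ = d′ ,
  trans (ℕ.+-suc d′ (length zs)) (trans (cong suc eq) (sym (ℕ.+-suc d (length xs)))) ,
  subst (λ xs → Transforms d′ i xs ts) (++-assoc us [ z ] xs) t′

-- The sequence deletes `xs` down to `zs` and then inserts up to `ys`. It is built from its end, so
-- the insertions are produced first.
⊆⇒Transforms : {zs xs ys : List A} → zs ⊆ xs → zs ⊆ ys →
  ∃[ d ] ∃[ i ] d + length zs ≡ length xs × i + length zs ≡ length ys × Transforms d i xs ys
⊆⇒Transforms zs⊆xs zs⊆ys with insert-⊆ [] zs⊆ys done
... | i , i+≡ , t with delete-⊆ [] zs⊆xs t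
... | d , d+≡ , t′ = d , i , d+≡ , i+≡ , t′

-- Equality of the two lists of symbols forces equal lengths, so `zip` discards nothing.
commonEdges : (xs : Vec A a) (ys : Vec A b) {us : List (Fin a)} {vs : List (Fin b)} →
  AllPairs _<ᶠ_ us → AllPairs _<ᶠ_ vs → map (lookup xs) us ≡ map (lookup ys) vs →
  AllPairs _≺_ (List.zip us vs) × All (λ (u , v) → lookup xs u ≡ lookup ys v) (List.zip us vs) ×
  length (List.zip us vs) ≡ length us
commonEdges xs ys {[]}     {_}      _ _ _ = [] , [] , refl
commonEdges xs ys {u ∷ us} {v ∷ vs} (u<us ∷ us<) (v<vs ∷ vs<) eq
  with commonEdges xs ys us< vs< (∷-injectiveʳ eq)
... | E≺ , E= , ∣E∣ = All-zip u<us v<vs ∷ E≺ , ∷-injectiveˡ eq ∷ E= , cong suc ∣E∣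
  where
  All-zip : ∀ {P : Pred (Fin a) 0ℓ} {Q : Pred (Fin b) 0ℓ} {us vs} → All P us → All Q vs →
            All (λ (u , v) → P u × Q v) (List.zip us vs)
  All-zip []         _          = []
  All-zip (_ ∷ _)    []         = []
  All-zip (Pu ∷ Pus) (Qv ∷ Qvs) = (Pu , Qv) ∷ All-zip Pus Qvs

-- Each symbol of the common subsequence has a position in either string; these pairs are the edges
-- of the alignment with which the output is compared.
Transforms⇒edges : ∀ {d i} (xs : Vec A a) (ys : Vec A b) → Transforms d i (toList xs) (toList ys) →
  ∃[ E ] AllPairs _≺_ E × All (λ (u , v) → lookup xs u ≡ lookup ys v) E × a ≤ length E + d × b ≤ length E + i
Transforms⇒edges {d = d} {i} xs ys t with Transforms⇒⊆ t
... | zs , zs⊆xs , zs⊆ys , xs≤ , ys≤ with ⊆⇒Increasing xs zs⊆xs | ⊆⇒Increasing ys zs⊆ys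
... | us , us↑ , refl | vs , vs↑ , eq
  with commonEdges xs ys (Increasing⇒AllPairs us↑) (Increasing⇒AllPairs vs↑) (sym eq)
... | E≺ , E= , ∣E∣ = List.zip us vs , E≺ , E= ,
  subst₂ _≤_ (length-toList xs) (cong (_+ d) ∣zs∣) xs≤ , subst₂ _≤_ (length-toList ys) (cong (_+ i) ∣zs∣) ys≤
  where
  ∣zs∣ = trans (length-map (lookup xs) us) (sym ∣E∣)

∃-ofLength? : {P : Pred (List (Fin a × Fin b)) 0ℓ} → Decidable P → ∀ n → Dec (∃[ E ] length E ≡ n × P E)
∃-ofLength? P? zero with P? []
... | yes P[] = yes ([] , refl , P[])
... | no ¬P[] = no λ where ([] , refl , P[]) → ¬P[] P[]
∃-ofLength? P? (suc n) with any? (λ u → any? (λ v → ∃-ofLength? (λ E → P? ((u , v) ∷ E)) n))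
... | yes (u , v , E , refl , PE) = yes ((u , v) ∷ E , refl , PE)
... | no ¬∃ = no λ where ((u , v) ∷ E , refl , PE) → ¬∃ (u , v , E , refl , PE)

-- Descends from the bound `n` to the first length that is attained, testing each length by
-- exhaustive search; `P[]` settles length 0.
largest : {P : Pred (List (Fin a × Fin b)) 0ℓ} → Decidable P → P [] → ∀ n → (∀ E → P E → length E ≤ n) →
          ∃[ E ] P E × (∀ E′ → P E′ → length E′ ≤ length E)
largest P? P[] zero    bound = [] , P[] , bound
largest P? P[] (suc n) bound with ∃-ofLength? P? (suc n)
... | yes (E , ∣E∣ , PE) = E , PE , λ E′ PE′ → subst (length E′ ≤_) (sym ∣E∣) (bound E′ PE′)
... | no ¬∃ = largest P? P[] n λ E PE → ℕ.s≤s⁻¹ (ℕ.≤∧≢⇒< (bound E PE) (λ eq → ¬∃ (E , eq , PE)))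

-- Charging lost edges to unmatched symbols

AllPairs-resp-⊆ : {R : Rel A 0ℓ} {xs ys : List A} → xs ⊆ ys → AllPairs R ys → AllPairs R xs
AllPairs-resp-⊆ []          []         = []
AllPairs-resp-⊆ (_ ∷ʳ xs⊆)  (_ ∷ Rys)  = AllPairs-resp-⊆ xs⊆ Rys
AllPairs-resp-⊆ (refl ∷ xs⊆) (Ry ∷ Rys) = All-resp-⊆ xs⊆ Ry ∷ AllPairs-resp-⊆ xs⊆ Rys

length-filter-¬ : {P : Pred A 0ℓ} (P? : Decidable P) (xs : List A) →
                  length (filter P? xs) + length (filter (λ x → ¬? (P? x)) xs) ≡ length xs
length-filter-¬ P? [] = refl
length-filter-¬ P? (x ∷ xs) with P? x
... | yes _ = cong suc (length-filter-¬ P? xs)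
... | no  _ = trans (ℕ.+-suc _ _) (cong suc (length-filter-¬ P? xs))

-- Each of the `s` possible values of `f` accounts for at most `B / Q` elements. The induction
-- splits off the largest value, which is `lo + s` in the step for `suc s`; `few` speaks of all
-- sublists so that it passes to the remaining elements.
pigeonhole : (f : A → ℕ) (Q B lo s : ℕ) (xs : List A) →
             All (λ x → lo ≤ f x × f x < lo + s) xs →
             (∀ xs′ j → xs′ ⊆ xs → All (λ x → f x ≡ j) xs′ → Q * length xs′ ≤ B) →
             Q * length xs ≤ s * B
pigeonhole f Q B lo zero [] _ few = ℕ.≤-reflexive (ℕ.*-zeroʳ Q)
pigeonhole f Q B lo zero (x ∷ xs) ((lo≤ , <lo) ∷ _) few =
  contradiction (ℕ.≤-trans <lo (ℕ.≤-trans (ℕ.≤-reflexive (ℕ.+-identityʳ lo)) lo≤)) (ℕ.<-irrefl refl)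
pigeonhole f Q B lo (suc s) xs box few = begin
  Q * length xs                                      ≡⟨ cong (Q *_) (length-filter-¬ last? xs) ⟨
  Q * (length (filter last? xs) + length others)     ≡⟨ ℕ.*-distribˡ-+ Q (length (filter last? xs)) _ ⟩
  Q * length (filter last? xs) + Q * length others
    ≤⟨ ℕ.+-mono-≤ (few _ (lo + s) (filter-⊆ last? xs) (all-filter last? xs))
                     (pigeonhole f Q B lo s others box′ few′) ⟩
  B + s * B                                          ∎
  where
  open ℕ.≤-Reasoning
  last? = λ x → f x ℕ.≟ lo + s
  others = filter (λ x → ¬? (last? x)) xs
  box′ : All (λ x → lo ≤ f x × f x < lo + s) others
  box′ = All.zipWith (λ {x} (≢ , lo≤ , <) → lo≤ , ℕ.≤∧≢⇒< (ℕ.s≤s⁻¹ (subst (f x <_) (ℕ.+-suc lo s) <)) ≢)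
           (all-filter (λ x → ¬? (last? x)) xs , All-filter⁺ (λ x → ¬? (last? x)) box)
  few′ = λ xs′ j xs′⊆ → few xs′ j (⊆-trans xs′⊆ (filter-⊆ (λ x → ¬? (last? x)) xs))

length-between : ∀ {c c′} {ns : List ℕ} → c ≤ c′ → AllPairs _<_ ns → All (λ n → c ≤ n × n < c′) ns →
                 length ns + c ≤ c′
length-between c≤c′ [] [] = c≤c′
length-between {c} {c′} {n ∷ ns} c≤c′ (n<ns ∷ ns<) ((c≤n , n<c′) ∷ box) = begin
  suc (length ns + c)  ≤⟨ s≤s (ℕ.+-monoʳ-≤ (length ns) c≤n) ⟩
  suc (length ns + n)  ≡⟨ ℕ.+-suc (length ns) n ⟨
  length ns + suc n    ≤⟨ length-between n<c′ ns< (All.zipWith (λ (n< , _ , <c′) → n< , <c′) (n<ns , box)) ⟩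
  c′                   ∎
  where open ℕ.≤-Reasoning

row : Fin a × Fin b → ℕ
row (u , _) = toℕ u

column : Fin a × Fin b → ℕ
column (_ , v) = toℕ v

Box : (c c′ d d′ : ℕ) → Pred (Fin a × Fin b) 0ℓ
Box c c′ d d′ e = (c ≤ row e × row e < c′) × (d ≤ column e × column e < d′)

Box⇒length+≤ : ∀ {c c′ d d′} {E : List (Fin a × Fin b)} → AllPairs _≺_ E → All (Box c c′ d d′) E → c ≤ c′ →
               length E + c ≤ c′
Box⇒length+≤ {c = c} {c′} {E = E} E≺ box c≤c′ = subst (λ n → n + c ≤ c′) (length-map row E)
  (length-between c≤c′ (AllPairs-map⁺ (AllPairs.map proj₁ E≺)) (All-map⁺ (All.map proj₁ box)))

Box⇒length≤ : ∀ {c c′} i N {E : List (Fin a × Fin b)} → AllPairs _≺_ E → All (Box c c′ (i * N) (suc i * N)) E →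
              length E ≤ N
Box⇒length≤ i N {E} E≺ box = ℕ.+-cancelʳ-≤ (i * N) (length E) N
  (subst (λ n → n + i * N ≤ suc i * N) (length-map column E) (length-between (ℕ.m≤n+m (i * N) N)
    (AllPairs-map⁺ (AllPairs.map proj₂ E≺)) (All-map⁺ (All.map proj₂ box))))

-- Columns increase along `E`, so the edges left of column `t` form a prefix `E₀`. The cut `c′` is
-- one past the row of the last edge of `E₀`, or `c` if `E₀` is empty.
cut : ∀ {c R d d′} t (E : List (Fin a × Fin b)) → c ≤ R → AllPairs _≺_ E → All (Box c R d d′) E →
      ∃[ E₀ ] ∃[ E₁ ] ∃[ c′ ] (E ≡ E₀ ++ E₁ × c ≤ c′ × c′ ≤ R ×
        AllPairs _≺_ E₀ × AllPairs _≺_ E₁ × All (Box c c′ d t) E₀ × All (Box c′ R t d′) E₁)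
cut {c = c} t [] c≤R _ _ = [] , [] , c , refl , ℕ.≤-refl , c≤R , [] , [] , [] , []
cut {c = c} {R} t (e@(u , v) ∷ E) c≤R (e≺ ∷ E≺) (box-e@((c≤u , u<R) , d≤v , _) ∷ box) with toℕ v ℕ.<? t
... | no v≮t = [] , e ∷ E , c , refl , ℕ.≤-refl , c≤R , [] , e≺ ∷ E≺ , [] ,
  (proj₁ box-e , ℕ.≮⇒≥ v≮t , proj₂ (proj₂ box-e)) ∷
  All.zipWith (λ ((_ , v<) , rows , _ , <d′) → rows , ℕ.≤-trans (ℕ.≮⇒≥ v≮t) (ℕ.<⇒≤ v<) , <d′) (e≺ , box)
-- Restarting from row `suc u` places the cut beyond the row of `e`.
... | yes v<t with cut t E u<R E≺ (All.zipWith (λ ((u< , _) , (_ , <R) , cols) → (u< , <R) , cols) (e≺ , box))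
...   | E₀ , E₁ , c′ , refl , u<c′ , c′≤R , E₀≺ , E₁≺ , box₀ , box₁ =
  e ∷ E₀ , E₁ , c′ , refl , ℕ.≤-trans c≤u (ℕ.<⇒≤ u<c′) , c′≤R ,
  All-++⁻ˡ E₀ e≺ ∷ E₀≺ , E₁≺ ,
  ((c≤u , u<c′) , d≤v , v<t) ∷ All.map (λ ((u< , <c′) , cols) → (ℕ.≤-trans c≤u (ℕ.<⇒≤ u<) , <c′) , cols) box₀ ,
  box₁

module _ (P Q N : ℕ) where

  -- Of the e edges between c′ - c rows and n columns, e′ are retained.  With ε = P / Q, the inequality
  -- says 2 (e - e′) ≤ 11 ε (c′ - c + n - 2 e), with both sides moved so that no subtraction occurs.
  Retains : (e e′ c c′ n : ℕ) → Set
  Retains e e′ c c′ n = (2 * Q + 22 * P) * e + 11 * P * c ≤ 2 * Q * e′ + 11 * P * (c′ + n)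

  -- The sum of the two inequalities has `11 * P * c₁` on both sides; cancelling it makes the row
  -- intervals telescope.
  Retains-++ : ∀ {e₀ e₁ e₀′ e₁′ c₀ c₁ c₂ n₀ n₁} → Retains e₀ e₀′ c₀ c₁ n₀ → Retains e₁ e₁′ c₁ c₂ n₁ →
               Retains (e₀ + e₁) (e₀′ + e₁′) c₀ c₂ (n₀ + n₁)
  Retains-++ {e₀} {e₁} {e₀′} {e₁′} {c₀} {c₁} {c₂} {n₀} {n₁} r₀ r₁ =
    ℕ.+-cancelʳ-≤ (11 * P * c₁) _ _
      (subst₂ _≤_ (lhs P Q e₀ e₁ c₀ c₁) (rhs P Q e₀′ e₁′ c₁ c₂ n₀ n₁) (ℕ.+-mono-≤ r₀ r₁))
    where
    lhs : ∀ P Q e₀ e₁ c₀ c₁ → ((2 * Q + 22 * P) * e₀ + 11 * P * c₀) + ((2 * Q + 22 * P) * e₁ + 11 * P * c₁) ≡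
                              ((2 * Q + 22 * P) * (e₀ + e₁) + 11 * P * c₀) + 11 * P * c₁
    lhs = solve-∀
    rhs : ∀ P Q e₀ e₁ c₁ c₂ n₀ n₁ → (2 * Q * e₀ + 11 * P * (c₁ + n₀)) + (2 * Q * e₁ + 11 * P * (c₂ + n₁)) ≡
                                    (2 * Q * (e₀ + e₁) + 11 * P * (c₂ + (n₀ + n₁))) + 11 * P * c₁
    rhs = solve-∀

  -- With no edge lost, it remains that the unmatched rows and columns are nonnegative in number;
  -- `e + c ≤ c′` gives this for the rows and `e ≤ N` for the columns.
  retain-all : ∀ {e c c′} → e + c ≤ c′ → e ≤ N → Retains e e c c′ N
  retain-all {e} {c} {c′} e+c≤c′ e≤N = begin
    (2 * Q + 22 * P) * e + 11 * P * c      ≡⟨ regroup P Q e c ⟩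
    2 * Q * e + 11 * P * (e + c + e)
      ≤⟨ ℕ.+-monoʳ-≤ (2 * Q * e) (ℕ.*-monoʳ-≤ (11 * P) (ℕ.+-mono-≤ e+c≤c′ e≤N)) ⟩
    2 * Q * e + 11 * P * (c′ + N)          ∎
    where
    open ℕ.≤-Reasoning
    regroup : ∀ P Q e c → (2 * Q + 22 * P) * e + 11 * P * c ≡ 2 * Q * e + 11 * P * (e + c + e)
    regroup = solve-∀

  -- By `11 * P ≤ Q`, the term `22 * P * e` is at most a second `2 * Q * e`. Then `4 * Q * e` is at
  -- most `4 * P * s * N`, and `s * N` is at most `c′ - c + 2 * N`. The resulting `8 * P * N` fits
  -- into `11 * P * N`.
  retain-none : ∀ {e c c′ s} → 11 * P ≤ Q → c ≤ c′ → s * N + c ≤ c′ + 2 * N → Q * e ≤ s * (P * N) →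
                Retains e 0 c c′ N
  retain-none {e} {c} {c′} {s} 11P≤Q c≤c′ sN≤ Qe≤ = begin
    (2 * Q + 22 * P) * e + 11 * P * c                ≡⟨ expand P Q e c ⟩
    2 * Q * e + 2 * (11 * P * e) + 11 * P * c
      ≤⟨ ℕ.+-monoˡ-≤ (11 * P * c) (ℕ.+-monoʳ-≤ (2 * Q * e) (ℕ.*-monoʳ-≤ 2 (ℕ.*-monoˡ-≤ e 11P≤Q))) ⟩
    2 * Q * e + 2 * (Q * e) + 11 * P * c             ≡⟨ collect P Q e c ⟩
    4 * (Q * e) + 11 * P * c                         ≤⟨ ℕ.+-monoˡ-≤ (11 * P * c) (ℕ.*-monoʳ-≤ 4 Qe≤) ⟩
    -- The coefficient 11 of `c` is divided into 4, which goes with `s * N`, and 7, which `c ≤ c′`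
    -- covers.
    4 * (s * (P * N)) + 11 * P * c                   ≡⟨ factor P N s c ⟩
    4 * P * (s * N + c) + 7 * P * c
      ≤⟨ ℕ.+-mono-≤ (ℕ.*-monoʳ-≤ (4 * P) sN≤) (ℕ.*-monoʳ-≤ (7 * P) c≤c′) ⟩
    4 * P * (c′ + 2 * N) + 7 * P * c′                ≤⟨ ℕ.m≤m+n _ (3 * P * N) ⟩
    4 * P * (c′ + 2 * N) + 7 * P * c′ + 3 * P * N    ≡⟨ total P Q N c′ ⟩
    2 * Q * 0 + 11 * P * (c′ + N)                    ∎
    where
    open ℕ.≤-Reasoning
    expand : ∀ P Q e c → (2 * Q + 22 * P) * e + 11 * P * c ≡ 2 * Q * e + 2 * (11 * P * e) + 11 * P * c
    expand = solve-∀
    collect : ∀ P Q e c → 2 * Q * e + 2 * (Q * e) + 11 * P * c ≡ 4 * (Q * e) + 11 * P * c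
    collect = solve-∀
    factor : ∀ P N s c → 4 * (s * (P * N)) + 11 * P * c ≡ 4 * P * (s * N + c) + 7 * P * c
    factor = solve-∀
    total : ∀ P Q N c → 4 * P * (c + 2 * N) + 7 * P * c + 3 * P * N ≡ 2 * Q * 0 + 11 * P * (c + N)
    total = solve-∀

  -- Induction on the number `n` of column blocks still to come, starting with block `i`: `cut`
  -- separates the edges into block `i` with their interval of rows, `step` treats them, and
  -- `Retains-++` adds up the results.
  retain : {k : ℕ} {G H : Pred (Fin a × Fin (k * N)) 0ℓ} →
           (∀ (i : Fin k) {c c′ E} → c ≤ c′ → All H E → AllPairs _≺_ E →
             All (Box c c′ (toℕ i * N) (suc (toℕ i) * N)) E →
             ∃[ E′ ] E′ ⊆ E × All G E′ × Retains (length E) (length E′) c c′ N) →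
           ∀ n i {c R E} → i + n ≡ k → c ≤ R → All H E → AllPairs _≺_ E → All (Box c R (i * N) (k * N)) E →
           ∃[ E′ ] E′ ⊆ E × All G E′ × Retains (length E) (length E′) c R (n * N)
  retain step zero i {E = []} i≡k c≤R HE E≺ box = [] , [] , [] , retain-nothing c≤R
    where
    retain-nothing : ∀ {c R} → c ≤ R → Retains 0 0 c R 0
    retain-nothing {c} {R} c≤R = ℕ.+-mono-≤
      (ℕ.≤-reflexive (trans (ℕ.*-zeroʳ (2 * Q + 22 * P)) (sym (ℕ.*-zeroʳ (2 * Q)))))
      (ℕ.*-monoʳ-≤ (11 * P) (ℕ.≤-trans c≤R (ℕ.m≤m+n R 0)))
  -- Here `i` equals `k`, so the column of an edge would be both at least and below `k * N`.
  retain step zero i {E = e ∷ E} i≡k c≤R HE E≺ ((_ , d≤ , <d′) ∷ _) =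
    contradiction (ℕ.≤-trans <d′ (subst (λ i → i * N ≤ column e) (trans (sym (ℕ.+-identityʳ i)) i≡k) d≤))
      (ℕ.<-irrefl refl)
  retain {k = k} step (suc n) i {c} {R} {E} i+n≡k c≤R HE E≺ box with cut (suc i * N) E c≤R E≺ box
  ... | E₀ , E₁ , c′ , refl , c≤c′ , c′≤R , E₀≺ , E₁≺ , box₀ , box₁
    with step (fromℕ< i<k) c≤c′ (All-++⁻ˡ E₀ HE) E₀≺
           (subst (λ i → All (Box c c′ (i * N) (suc i * N)) E₀) (sym (toℕ-fromℕ< i<k)) box₀)
       | retain step n (suc i) (trans (sym (ℕ.+-suc i n)) i+n≡k) c′≤R (All-++⁻ʳ E₀ HE) E₁≺ box₁
    where
    i<k : i < k
    i<k = subst (suc i ≤_) (trans (sym (ℕ.+-suc i n)) i+n≡k) (ℕ.m≤m+n (suc i) n)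
  ... | E₀′ , E₀′⊆ , GE₀′ , r₀ | E₁′ , E₁′⊆ , GE₁′ , r₁ =
    E₀′ ++ E₁′ , ⊆-++⁺ E₀′⊆ E₁′⊆ , All-++⁺ GE₀′ GE₁′ ,
    subst₂ (λ e e′ → Retains e e′ c R (suc n * N)) (sym (length-++ E₀)) (sym (length-++ E₀′))
      (Retains-++ {length E₀} {length E₁} {length E₀′} {length E₁′} {c} {c′} {R} {N} {n * N} r₀ r₁)

-- Codeword blocks and the decoder

toℕ-quotient-remainder : ∀ {k} N (u : Fin (k * N)) → toℕ u ≡ toℕ (quotient {k} N u) * N + toℕ (remainder {k} N u)
toℕ-quotient-remainder {k} N u = begin
  toℕ u                                                              ≡⟨ cong toℕ (combine-remQuot {k} N u) ⟨
  toℕ (combine (quotient {k} N u) (remainder {k} N u))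
    ≡⟨ toℕ-combine (quotient {k} N u) (remainder {k} N u) ⟩
  N * toℕ (quotient {k} N u) + toℕ (remainder {k} N u)
    ≡⟨ cong (_+ toℕ (remainder {k} N u)) (ℕ.*-comm N _) ⟩
  toℕ (quotient {k} N u) * N + toℕ (remainder {k} N u)               ∎
  where open ≡-Reasoning

quotient*≤ : ∀ {k} N (u : Fin (k * N)) → toℕ (quotient {k} N u) * N ≤ toℕ u
quotient*≤ {k} N u = subst (toℕ (quotient {k} N u) * N ≤_) (sym (toℕ-quotient-remainder {k} N u)) (ℕ.m≤m+n _ _)

<suc-quotient* : ∀ {k} N (u : Fin (k * N)) → toℕ u < suc (toℕ (quotient {k} N u)) * N
<suc-quotient* {k} N u = begin-strict
  toℕ u                                                     ≡⟨ toℕ-quotient-remainder {k} N u ⟩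
  toℕ (quotient {k} N u) * N + toℕ (remainder {k} N u)      <⟨ ℕ.+-monoʳ-< _ (toℕ<n (remainder {k} N u)) ⟩
  toℕ (quotient {k} N u) * N + N                            ≡⟨ ℕ.+-comm _ N ⟩
  suc (toℕ (quotient {k} N u)) * N                          ∎
  where open ℕ.≤-Reasoning

m<suc[m/n]*n : ∀ m n .{{_ : NonZero n}} → m < suc (m / n) * n
m<suc[m/n]*n m n = subst (_< suc (m / n) * n) (sym (m≡m%n+[m/n]*n m n)) (ℕ.+-monoˡ-< (m / n * n) (m%n<n m n))

-- Compares block numbers through a position `x` that they enclose, for `quotient` and `/` alike.
i*n≤x<suc[j]*n⇒i≤j : ∀ {i j x} n → i * n ≤ x → x < suc j * n → i ≤ j
i*n≤x<suc[j]*n⇒i≤j {i} {j} n ≤x x< = ℕ.s≤s⁻¹ (ℕ.*-cancelʳ-< n i (suc j) (ℕ.≤-<-trans ≤x x<))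

quotient≡ : ∀ {k N} {i : Fin k} (v : Fin (k * N)) → toℕ i * N ≤ toℕ v → toℕ v < suc (toℕ i) * N →
            quotient {k} N v ≡ i
quotient≡ {k} {N} v ≤v v< = toℕ-injective (ℕ.≤-antisym
  (i*n≤x<suc[j]*n⇒i≤j N (quotient*≤ {k} N v) v<) (i*n≤x<suc[j]*n⇒i≤j N ≤v (<suc-quotient* {k} N v)))

-- Only the first and the last of the `s` consecutive blocks can be met in part, whence the
-- allowance `2 * N`.
blocks-met : ∀ {c c′} N .{{_ : NonZero N}} → c < c′ →
  ∃[ lo ] ∃[ s ] s * N + c ≤ c′ + 2 * N ×
  (∀ {M} (u : Fin (M * N)) → c ≤ toℕ u → toℕ u < c′ →
   lo ≤ toℕ (quotient {M} N u) × toℕ (quotient {M} N u) < lo + s)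
-- After the match `c′` is the last row itself, so `hi` is the last block met and there are
-- `suc hi ∸ lo` blocks.
blocks-met {c} {suc c′} N (s≤s c≤c′) = lo , suc hi ∸ lo , bound , range
  where
  lo = c / N
  hi = c′ / N
  lo≤hi : lo ≤ hi
  lo≤hi = i*n≤x<suc[j]*n⇒i≤j N (ℕ.≤-trans (m/n*n≤m c N) c≤c′) (m<suc[m/n]*n c′ N)
  lo+s : lo + (suc hi ∸ lo) ≡ suc hi
  lo+s = ℕ.m+[n∸m]≡n (ℕ.m≤n⇒m≤1+n lo≤hi)
  range : ∀ {M} (u : Fin (M * N)) → c ≤ toℕ u → toℕ u < suc c′ →
           lo ≤ toℕ (quotient {M} N u) × toℕ (quotient {M} N u) < lo + (suc hi ∸ lo)
  range {M} u c≤u u<c′ = i*n≤x<suc[j]*n⇒i≤j N (ℕ.≤-trans (m/n*n≤m c N) c≤u) (<suc-quotient* {M} N u) ,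
    subst (toℕ (quotient {M} N u) <_) (sym lo+s)
      (s≤s (i*n≤x<suc[j]*n⇒i≤j N (ℕ.≤-trans (quotient*≤ {M} N u) (ℕ.s≤s⁻¹ u<c′)) (m<suc[m/n]*n c′ N)))
  open ℕ.≤-Reasoning
  bound : (suc hi ∸ lo) * N + c ≤ suc c′ + 2 * N
  bound = begin
    (suc hi ∸ lo) * N + c                 ≤⟨ ℕ.+-monoʳ-≤ _ (ℕ.<⇒≤ (m<suc[m/n]*n c N)) ⟩
    (suc hi ∸ lo) * N + suc lo * N        ≡⟨ shift lo (suc hi ∸ lo) N ⟩
    (lo + (suc hi ∸ lo)) * N + N          ≡⟨ cong (λ x → x * N + N) lo+s ⟩
    N + hi * N + N                        ≤⟨ ℕ.+-monoˡ-≤ N (ℕ.+-monoʳ-≤ N (m/n*n≤m c′ N)) ⟩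
    N + c′ + N                            ≤⟨ ℕ.n≤1+n _ ⟩
    suc (N + c′ + N)                      ≡⟨ regroup c′ N ⟩
    suc c′ + 2 * N                        ∎
    where
    shift : ∀ lo s N → s * N + suc lo * N ≡ (lo + s) * N + N
    shift = solve-∀
    regroup : ∀ c N → suc (N + c + N) ≡ suc c + 2 * N
    regroup = solve-∀

∣m-n∣≤s : ∀ {m n lo s} → lo ≤ m × m < lo + s → lo ≤ n × n < lo + s → ∣ m - n ∣ ≤ s
∣m-n∣≤s {m} {n} {lo} {s} (lo≤m , m<) (lo≤n , n<) with ℕ.∣m-n∣≡[m∸n]∨[n∸m] m n
... | inj₁ eq = subst (_≤ s) (sym eq) (ℕ.m≤n+o⇒m∸n≤o m n (ℕ.≤-trans (ℕ.<⇒≤ m<) (ℕ.+-monoˡ-≤ s lo≤n)))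
... | inj₂ eq = subst (_≤ s) (sym eq) (ℕ.m≤n+o⇒m∸n≤o n m (ℕ.≤-trans (ℕ.<⇒≤ n<) (ℕ.+-monoˡ-≤ s lo≤m)))

-- `combine i` reflects the order, so the remainders of increasing positions in block `i` increase,
-- and `combine i` recovers the positions from them.
block-⊆ : ∀ {k N} (xs : Vec A (k * N)) {i : Fin k} {us : List (Fin (k * N))} → AllPairs _<ᶠ_ us →
          All (λ u → quotient {k} N u ≡ i) us → map (lookup xs) us ⊆ toList (block k N xs i)
block-⊆ {k = k} {N} xs {i} {us} us< us∈i = subst (_⊆ toList (block k N xs i)) values
  (Increasing⇒⊆ (block k N xs i) (AllPairs⇒Increasing rs<))
  where
  rs = map (remainder {k} N) us
  us≡ : map (combine i) rs ≡ us
  us≡ = trans (sym (map-∘ us)) (map-id-local (All.map (λ {u} q≡i →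
    trans (cong (λ i → combine i (remainder {k} N u)) (sym q≡i)) (combine-remQuot {k} N u)) us∈i))
  combine-cancel-< : ∀ {r r′ : Fin N} → combine i r <ᶠ combine i r′ → r <ᶠ r′
  combine-cancel-< {r} {r′} lt = ℕ.+-cancelˡ-< (N * toℕ i) _ _ (subst₂ _<_ (toℕ-combine i r) (toℕ-combine i r′) lt)
  rs< : AllPairs _<ᶠ_ rs
  rs< = AllPairs.map combine-cancel-< (AllPairs-map⁻ (subst (AllPairs _<ᶠ_) (sym us≡) us<))
  values : map (lookup (block k N xs i)) rs ≡ map (lookup xs) us
  values = begin
    map (lookup (block k N xs i)) rs
      ≡⟨ map-cong (lookup∘tabulate (λ t → lookup xs (combine i t))) rs ⟩
    map (lookup xs ∘ combine i) rs            ≡⟨ map-∘ rs ⟩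
    map (lookup xs) (map (combine i) rs)      ≡⟨ cong (map (lookup xs)) us≡ ⟩
    map (lookup xs) us                        ∎
    where open ≡-Reasoning

block-indexed : ∀ {p q N M} (C : Code q N M) (m : Vec (Fin p) (M * N)) j →
                Vec.map proj₂ (block M N (indexed C m) j) ≡ C j
block-indexed {N = N} C m j = begin
  Vec.map proj₂ (tabulate λ t → lookup (indexed C m) (combine j t))   ≡⟨ tabulate-∘ proj₂ _ ⟨
  tabulate (λ t → proj₂ (lookup (indexed C m) (combine j t)))         ≡⟨ tabulate-cong pointwise ⟩
  tabulate (lookup (C j))                                             ≡⟨ tabulate∘lookup (C j) ⟩
  C j                                                                 ∎
  where
  open ≡-Reasoning
  pointwise : ∀ t → proj₂ (lookup (indexed C m) (combine j t)) ≡ lookup (C j) t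
  pointwise t = begin
    proj₂ (lookup (indexed C m) (combine j t))
      ≡⟨ cong proj₂ (lookup-zip (combine j t) m (indexString C)) ⟩
    lookup (indexString C) (combine j t)          ≡⟨ lookup-concat (tabulate C) j t ⟩
    lookup (lookup (tabulate C) j) t              ≡⟨ cong (λ xs → lookup xs t) (lookup∘tabulate C j) ⟩
    lookup (C j) t                                ∎

-- The graph of the algorithm and its approximation guarantee

approxGraph? : ∀ {p q} N M k ε .{{_ : Positive ε}} (dec : List (Fin q) → Subset M)
  (S : Vec (Fin p × Fin q) (M * N)) (S′ : Vec (Fin p × Fin q) (k * N)) →
  B.Decidable (approxGraph N M k ε dec S S′)
approxGraph? N M k ε dec S S′ u v = any? λ j →
  (j ∈? dec _) ×-dec (_ ℚ.≤? window ε) ×-dec ≡-dec _≟ᶠ_ _≟ᶠ_ (lookup S u) (lookup S′ v)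

nonCrossingMatching? : {G : REL (Fin a) (Fin b) 0ℓ} → B.Decidable G → Decidable (NonCrossingMatching G)
nonCrossingMatching? G? E = All.all? (λ (u , v) → G? u v) E ×-dec
  AllPairs.allPairs? (λ (u , v) (u′ , v′) → (toℕ u ℕ.<? toℕ u′) ×-dec (toℕ v ℕ.<? toℕ v′)) E

module _ {p q N M L k : ℕ} (ε : ℚ) .{{_ : Positive ε}} (ε<1/21 : ε ℚ.< + 1 ℚ./ 21)
         (C : Code q N M) (D : ListDecoder C L ε)
         (m : Vec (Fin p) (M * N)) (S′ : Vec (Fin p × Fin q) (k * N)) where

  private
    S = indexed C m
    Edge = Fin (M * N) × Fin (k * N)
    G : Pred Edge 0ℓ
    G (u , v) = approxGraph N M k ε (ListDecoder.dec D) S S′ u v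
    SameSymbol : Pred Edge 0ℓ
    SameSymbol (u , v) = lookup S u ≡ lookup S′ v
    codewordOf : Edge → Fin M
    codewordOf (u , _) = quotient {M} N u
    blockOf : Edge → Fin k
    blockOf (_ , v) = quotient {k} N v
    index : Fin k → List (Fin q)
    index i = toList (Vec.map proj₂ (block k N S′ i))

  module _ {P Q : ℕ} {{_ : NonZero P}} {{_ : NonZero Q}} (P≡ε*Q : fromℕ P ≡ ε ℚ.* fromℕ Q) where

    open Fraction {ε = ε} P≡ε*Q

    -- The index components of the edges in `F` spell a common subsequence of `C j` and `index i`.
    -- Both strings have length `N` and share at least `ε N` symbols in this way, which leaves at
    -- most `N (1 - ε)` deletions and at most `N (1 - ε)` insertions.
    heavy⇒decoded : ∀ {i j F} → All SameSymbol F → AllPairs _≺_ F →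
                    All (λ e → codewordOf e ≡ j) F → All (λ e → blockOf e ≡ i) F →
                    P * N ≤ Q * length F → j ∈ ListDecoder.dec D (index i)
    heavy⇒decoded {i} {j} {F} F= F≺ F∈j F∈i heavy
      with ⊆⇒Transforms zs⊆Cj zs⊆index
      where
      zs = map (λ (u , _) → proj₂ (lookup S u)) F
      zs⊆Cj : zs ⊆ toList (C j)
      zs⊆Cj = subst₂ _⊆_ (trans (cong (map proj₂) (sym (map-∘ F))) (sym (map-∘ F)))
        (trans (sym (toList-map proj₂ (block M N S j))) (cong toList (block-indexed C m j)))
        (⊆-map⁺ proj₂ (block-⊆ {k = M} S (AllPairs-map⁺ (AllPairs.map proj₁ F≺)) (All-map⁺ F∈j)))
      zs⊆index : zs ⊆ index i
      -- By `F=`, the same `zs` can be read off in `S′`.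
      zs⊆index = subst₂ _⊆_
        (trans (cong (map proj₂) (trans (sym (map-∘ F)) (sym (map-cong-local F=)))) (sym (map-∘ F)))
        (sym (toList-map proj₂ (block k N S′ i)))
        (⊆-map⁺ proj₂ (block-⊆ {k = k} S′ (AllPairs-map⁺ (AllPairs.map proj₂ F≺)) (All-map⁺ F∈i)))
    ... | d , i′ , d+ , i+ , t = Equivalence.from (ListDecoder.dec-spec D (index i) j)
      (d , i′ , ≤*[1-ε] d (length F) N (total (length-map _ F) (length-toList (C j)) d+) heavy
              , ≤*[1-ε] i′ (length F) N
                  (total (length-map _ F) (length-toList (Vec.map proj₂ (block k N S′ i))) i+) heavy , t)
      where
      total : ∀ {d n n′} → n ≡ length F → n′ ≡ N → d + n ≡ n′ → d + length F ≡ N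
      total {d} n≡ n′≡ d+n≡n′ = trans (cong (_+_ d) (sym n≡)) (trans d+n≡n′ n′≡)

    -- The codeword of `e` and `j` lie among the same `s` consecutive blocks, hence at distance at
    -- most `s`, and `s * P ≤ Q` puts this within `1/ε`.
    window-edge : ∀ {i j lo s e} → j ∈ ListDecoder.dec D (index i) → SameSymbol e → blockOf e ≡ i →
                  s * P ≤ Q → lo ≤ toℕ j × toℕ j < lo + s →
                  lo ≤ toℕ (codewordOf e) × toℕ (codewordOf e) < lo + s → G e
    window-edge {j = j} {e = e} j∈ e= refl sP≤Q j-range e-range =
      j , j∈ , ≤window ∣ toℕ (codewordOf e) - toℕ j ∣
        (ℕ.≤-trans (ℕ.*-monoˡ-≤ P (∣m-n∣≤s e-range j-range)) sP≤Q) , e=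

    retain-block : ∀ (i : Fin k) {c c′ E} → c ≤ c′ → All SameSymbol E → AllPairs _≺_ E →
      All (Box c c′ (toℕ i * N) (suc (toℕ i) * N)) E →
      ∃[ E′ ] E′ ⊆ E × All G E′ × Retains P Q N (length E) (length E′) c c′ N
    -- In the other case a first edge shows that `N` is nonzero, by its end in `S′`, and that
    -- `c < c′`; `blocks-met` requires both.
    retain-block i {E = []} c≤c′ _ _ _ = [] , [] , [] , retain-all P Q N c≤c′ z≤n
    retain-block i {c} {c′} {E@((u₀ , v₀) ∷ _)} c≤c′ E= E≺ box@(((c≤u₀ , u₀<c′) , _) ∷ _)
      with blocks-met N {{nonZeroIndex (remainder {k} N v₀)}} (ℕ.≤-<-trans c≤u₀ u₀<c′)
    ... | lo , s , sN≤ , ranges with s * P ℕ.≤? Q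
    -- More than `1/ε` blocks are met, so `length E ≤ N` is itself at most `s ε N`.
    ...   | no sP≰Q = [] , minimum E , [] , retain-none P Q N {s = s} (<1/21⇒*11≤ ε<1/21) c≤c′ sN≤ (begin
      Q * length E     ≤⟨ ℕ.*-monoʳ-≤ Q (Box⇒length≤ (toℕ i) N E≺ box) ⟩
      Q * N            ≤⟨ ℕ.*-monoˡ-≤ N (ℕ.<⇒≤ (ℕ.≰⇒> sP≰Q)) ⟩
      s * P * N        ≡⟨ ℕ.*-assoc s P N ⟩
      s * (P * N)      ∎)
      where open ℕ.≤-Reasoning
    ...   | yes sP≤Q
            -- Testing the codewords of the edges in `E` covers every nonempty fibre of
            -- `codewordOf`.
            with Any.any? (λ e → P * N ℕ.≤? Q * length (filter (λ e′ → codewordOf e′ ≟ᶠ codewordOf e) E)) E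
    ...     | yes heavy = E , ⊆-refl , GE , retain-all P Q N (Box⇒length+≤ E≺ box c≤c′)
                                                        (Box⇒length≤ (toℕ i) N E≺ box)
      where
      range : ∀ {e} → Box c c′ (toℕ i * N) (suc (toℕ i) * N) e →
              lo ≤ toℕ (codewordOf e) × toℕ (codewordOf e) < lo + s
      range {u , _} ((c≤u , u<c′) , _) = ranges {M} u c≤u u<c′
      E∈i : All (λ e → blockOf e ≡ i) E
      E∈i = All.map (λ { {_ , v} (_ , ≤v , v<) → quotient≡ {k} v ≤v v< }) box
      -- The single decoded codeword of `e₀` serves all edges of `E`, as their codewords lie among
      -- at most `1/ε` blocks.
      GE : All G E
      GE with find heavy
      ... | e₀ , e₀∈E , PN≤ = All.zipWith (λ (e= , e∈i , e-box) →
              window-edge j∈ e= e∈i sP≤Q (range (All.lookup box e₀∈E)) (range e-box)) (E= , All.zip (E∈i , box))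
        where
        F⊆E = filter-⊆ (λ e′ → codewordOf e′ ≟ᶠ codewordOf e₀) E
        j∈ = heavy⇒decoded (All-resp-⊆ F⊆E E=) (AllPairs-resp-⊆ F⊆E E≺)
               (all-filter (λ e′ → codewordOf e′ ≟ᶠ codewordOf e₀) E) (All-resp-⊆ F⊆E E∈i) PN≤
    ...     | no light = [] , minimum E , [] , retain-none P Q N {s = s} (<1/21⇒*11≤ ε<1/21) c≤c′ sN≤
      (pigeonhole (toℕ ∘ codewordOf) Q (P * N) lo s E
        (All.map (λ { {u , _} ((c≤u , u<c′) , _) → ranges {M} u c≤u u<c′ }) box) few)
      where
      few : ∀ F j → F ⊆ E → All (λ e → toℕ (codewordOf e) ≡ j) F → Q * length F ≤ P * N
      few [] j _ _ = ℕ.≤-trans (ℕ.≤-reflexive (ℕ.*-zeroʳ Q)) z≤n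
      -- `F` is a sublist of the fibre of its first edge `e` in `E`, which `light` bounds because
      -- `e` belongs to `E`.
      few F@(e ∷ _) j F⊆E F∈j@(e∈j ∷ _) = begin
        Q * length F
          ≡⟨ cong ((Q *_) ∘ length) (filter-all same? (All.map (λ e′∈j → toℕ-injective (trans e′∈j (sym e∈j))) F∈j)) ⟨
        Q * length (filter same? F)
          ≤⟨ ℕ.*-monoʳ-≤ Q (length-mono-≤ (filter⁺ same? same? (λ { refl same → same }) F⊆E)) ⟩
        Q * length (filter same? E)       ≤⟨ ℕ.<⇒≤ (ℕ.≰⇒> (All.head (All-resp-⊆ F⊆E (¬Any⇒All¬ E light)))) ⟩
        P * N                             ∎
        where
        open ℕ.≤-Reasoning
        same? = λ e′ → codewordOf e′ ≟ᶠ codewordOf e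

  -- The comparison is with any sequence of operations, in particular a shortest one. A non-crossing
  -- matching with `z` edges costs `M * N + k * N - 2 * z` operations, so it suffices that enough
  -- edges `E′` of the alignment `E*` lie in the graph.
  approximation : ∀ {E} → ED-Approx N M k ε (ListDecoder.dec D) S S′ E →
    ∀ {d i} → Transforms d i (toList S) (toList S′) →
    fromℕ (∣ deletions E ∣ + ∣ insertions E ∣) ℚ.≤ (1ℚ ℚ.+ (+ 11 ℚ./ 1) ℚ.* ε) ℚ.* fromℕ (d + i)
  approximation {E} ((_ , E≺) , E-largest) {d} {i} t
    with fraction ε | Transforms⇒edges S S′ t
  ... | P , Q , P≢0 , Q≢0 , P≡ε*Q | E* , E*≺ , E*= , ≤E*+d , ≤E*+i
    with retain P Q N {k = k} {G = G} (retain-block {{P≢0}} {{Q≢0}} P≡ε*Q) k 0 refl z≤n E*= E*≺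
           (All.universal (λ (u , v) → (z≤n , toℕ<n u) , z≤n , toℕ<n v) E*)
  ... | E′ , E′⊆E* , GE′ , retained =
    Fraction.≤[1+11ε]* {ε = ε} {{P≢0 = P≢0}} {{Q≢0 = Q≢0}} P≡ε*Q (∣ deletions E ∣ + ∣ insertions E ∣) (d + i)
      (bound (∣deletions∣+length E≺) (∣insertions∣+length E≺) (E-largest E′ (GE′ , AllPairs-resp-⊆ E′⊆E* E*≺)))
    where
    open ℕ.≤-Reasoning
    -- `x`, `y` and `z` are the numbers of deletions, insertions and edges of `E`. Adding
    -- `2 * Q * z + 11 * P * (M * N + k * N)` to both sides avoids subtraction.
    bound : ∀ {x y z} → x + z ≡ M * N → y + z ≡ k * N → length E′ ≤ z → Q * (x + y) ≤ (Q + 11 * P) * (d + i)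
    bound {x} {y} {z} x+z y+z E′≤z = ℕ.+-cancelʳ-≤ (2 * Q * z + 11 * P * (M * N + k * N)) _ _ (begin
      Q * (x + y) + (2 * Q * z + 11 * P * (M * N + k * N))
        ≡⟨ cong₂ (λ a b → Q * (x + y) + (2 * Q * z + 11 * P * (a + b))) x+z y+z ⟨
      Q * (x + y) + (2 * Q * z + 11 * P * ((x + z) + (y + z)))
        ≡⟨ collect P Q x y z ⟩
      (Q + 11 * P) * ((x + z) + (y + z))
        ≡⟨ cong₂ (λ a b → (Q + 11 * P) * (a + b)) x+z y+z ⟩
      (Q + 11 * P) * (M * N + k * N)
        ≤⟨ ℕ.*-monoʳ-≤ (Q + 11 * P) (ℕ.+-mono-≤ ≤E*+d ≤E*+i) ⟩
      (Q + 11 * P) * ((length E* + d) + (length E* + i))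
        -- The summand `11 * P * 0` gives the shape of `retained`, whose rows start at 0.
        ≡⟨ expand P Q (length E*) d i ⟩
      (Q + 11 * P) * (d + i) + ((2 * Q + 22 * P) * length E* + 11 * P * 0)
        ≤⟨ ℕ.+-monoʳ-≤ ((Q + 11 * P) * (d + i)) retained ⟩
      (Q + 11 * P) * (d + i) + (2 * Q * length E′ + 11 * P * (M * N + k * N))
        -- Here the maximality of `E` enters.
        ≤⟨ ℕ.+-monoʳ-≤ ((Q + 11 * P) * (d + i)) (ℕ.+-monoˡ-≤ _ (ℕ.*-monoʳ-≤ (2 * Q) E′≤z)) ⟩
      (Q + 11 * P) * (d + i) + (2 * Q * z + 11 * P * (M * N + k * N)) ∎)
      where
      collect : ∀ P Q x y z → Q * (x + y) + (2 * Q * z + 11 * P * ((x + z) + (y + z))) ≡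
                                (Q + 11 * P) * ((x + z) + (y + z))
      collect = solve-∀
      expand : ∀ P Q l d i → (Q + 11 * P) * ((l + d) + (l + i)) ≡
                             (Q + 11 * P) * (d + i) + ((2 * Q + 22 * P) * l + 11 * P * 0)
      expand = solve-∀

theorem4p4 :
    ∀ {p q N M L k : ℕ} (ε : ℚ) .{{_ : Positive ε}} → ε ℚ.< + 1 ℚ./ 21 →
    (C : Code q N M) (D : ListDecoder C L ε)
    (m : Vec (Fin p) (M ℕ.* N)) (S′ : Vec (Fin p × Fin q) (k ℕ.* N)) →
    let S = indexed C m
        Output = ED-Approx N M k ε (ListDecoder.dec D) S S′
    in
    (∃[ E ] Output E) ×
    (∀ E → Output E →
      insertAt (insertions E) S′ (deleteAt (deletions E) S) ≡ toList S′ ×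
      (∀ e → IsED (toList S) (toList S′) e →
        fromℕ (∣ deletions E ∣ ℕ.+ ∣ insertions E ∣)
          ℚ.≤ (1ℚ ℚ.+ (+ 11 ℚ./ 1) ℚ.* ε) ℚ.* fromℕ e))
theorem4p4 {N = N} {M} {k = k} ε ε<1/21 C D m S′ =
  -- The edges of a non-crossing matching have distinct rows, so `M * N` bounds their number.
  largest (nonCrossingMatching? (approxGraph? N M k ε (ListDecoder.dec D) S S′)) ([] , []) (M * N)
    (λ E (_ , E≺) → subst (length E ≤_) (∣deletions∣+length E≺) (ℕ.m≤n+m (length E) _)) ,
  λ E output@((GE , E≺) , _) →
    edit-correct E≺ S S′ (All.map (λ (_ , _ , _ , e=) → e=) GE) ,
    λ { _ ((d , i , refl , t) , _) → approximation {k = k} ε ε<1/21 C D m S′ output t }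
  where
  S = indexed C m
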